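{- Let $\mathcal A=(A,\le,\mathrm{app},\to,\mathsf k,\mathsf s,\Phi)$ be a full adjunction implicative ordered combinatory algebra, let $\mathcal K_{\mathcal A\bullet}$ be the abstract Krivine structure with $\Lambda=\Pi=A$, $s\perp\pi\iff s\le\pi$, $\mathrm{app}(s,t)=st$, $\mathrm{push}(s,\pi)=s\to\pi$, $\mathsf K=\mathsf k$, $\mathsf S=\mathsf s$, $\mathrm{QP}=\Phi$, and let $\mathcal A_{\mathcal K_{\mathcal A\bullet}\bullet}$ be the full adjunction implicative ordered combinatory algebra associated to $\mathcal K_{\mathcal A\bullet}$. Then the indexed preorders (triposes) $\mathbf P(\mathcal A)$ and $\mathbf P(\mathcal A_{\mathcal K_{\mathcal A\bullet}\bullet})$ are equivalent.
   Context: A full adjunction implicative ordered combinatory algebra is an inf-complete poset $(A,\le)$ with application $ab$ monotone in both arguments (associating to the left), implication $a\to b$ antimonotone in the first and monotone in the second argument, elements $\mathsf k,\mathsf s$ with $\mathsf k ab\le a$, $\mathsf s abc\le ac(bc)$, such that $a\le b\to c\iff ab\le c$, and a subset $\Phi$ closed under application containing $\mathsf s,\mathsf k$. For such $\mathcal A$, $\mathbf P(\mathcal A)$ is the functor $\mathbf{Set}^{op}\to\mathbf{Ord}$, $I\mapsto(A^I,\vdash)$ with $\varphi\vdash\psi$ iff $\exists r\in\Phi\ \forall i\in I,\ r\varphi(i)\le\psi(i)$, and $f\mapsto(\varphi\mapsto\varphi\circ f)$. Given an abstract Krivine structure $\mathcal K$ (sets $\Lambda,\Pi$, relation $\perp$,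 push $t\cdot\pi$, application, $\mathrm{QP}$, $\mathsf K,\mathsf S$), $\mathcal A_{\mathcal K\bullet}$ has carrier $\mathcal P_\bullet(\Pi)=\{P\subseteq\Pi:\widehat P=P\}$ (where ${}^\perp P=\{t:\forall\pi\in P,t\perp\pi\}$, $L^\perp=\{\pi:\forall t\in L,t\perp\pi\}$, $\overline P=({}^\perp P)^\perp$, $\widehat P=\bigcup_{\pi\in P}\overline{\{\pi\}}$) ordered by $\supseteq$, application $P\circ_\bullet Q=\{\pi:t\cdot\pi'\in P\ \forall t\in{}^\perp Q,\ \pi'\in\overline{\{\pi\}}\}$, implication $P\to_\bullet Q=\widehat{\{t\cdot\pi:t\in{}^\perp P,\pi\in Q\}}$, combinators $\mathsf k_\bullet=\{\mathsf E\mathsf K\}^\perp$, $\mathsf s_\bullet=\{\mathsf E((\mathsf B\mathsf E)\mathsf S)\}^\perp$ with $\mathsf E=\mathsf S(\mathsf K(\mathsf S\mathsf K\mathsf K))$, $\mathsf B=\mathsf S(\mathsf K\mathsf S)\mathsf K$, and filter $\{P\in\mathcal P_\bullet(\Pi):\exists t\in\mathrm{QP},\ t\perp P\}$. Indexed preorders $\mathbf C,\mathbf D$ are equivalent if there are indexed monotone maps $\sigma:\mathbf C\to\mathbf D$, $\tau:\mathbf D\to\mathbf C$ (families of monotone maps commuting with reindexing up to isomorphism) with $\tau\sigma\cong\mathrm{id}$ and $\sigma\tau\cong\mathrm{id}$ pointwise. -}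

module Defs where

open import Level using (Level; _⊔_; suc)
open import Data.Product using (∃; _×_; _,_; proj₁; proj₂; swap)
open import Function using (_⇔_; mk⇔; Equivalence; flip; id; _∘_)
open import Relation.Binary.Bundles using (Preorder; Poset)
open import Relation.Binary.Core using (Rel; REL; _Preserves₂_⟶_⟶_)
open import Relation.Binary.Definitions using (_Respects_)
open import Relation.Binary.Morphism.Bundles using (PreorderHomomorphism)
open import Relation.Binary.PropositionalEquality using (_≡_; refl; cong; _≗_)
open import Relation.Unary using (Pred; _∈_; _⊆_; _⊇_; _≐_; ｛_｝; ⋃)

-- Agda is predicative, so the carrier (level c) and the truth values (level ℓ)
-- have separate levels.  Inf-completeness is having infima of all families
-- indexed by types of level ℓ.  For c = ℓ these are the infima of all subsets
-- X : Pred Carrier ℓ: a subset is the family proj₁ : ∃ X → Carrier, and a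
-- family has the same lower bounds as its image.

record FullAdjunctionIOCA (c ℓ : Level) : Set (suc (c ⊔ ℓ)) where
  field
    poset : Poset c ℓ ℓ

  open Poset poset public

  infixl 9 _⊙_
  infixr 8 _⇒_

  field
    ⋀          : {I : Set ℓ} → (I → Carrier) → Carrier
    ⋀-lower    : ∀ {I : Set ℓ} (x : I → Carrier) i → ⋀ x ≤ x i
    ⋀-greatest : ∀ {I : Set ℓ} (x : I → Carrier) {a} → (∀ i → a ≤ x i) → a ≤ ⋀ x

    _⊙_    : Carrier → Carrier → Carrier
    _⇒_    : Carrier → Carrier → Carrier
    ⊙-mono : _⊙_ Preserves₂ _≤_ ⟶ _≤_ ⟶ _≤_
    ⇒-mono : _⇒_ Preserves₂ flip _≤_ ⟶ _≤_ ⟶ _≤_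

    k s   : Carrier
    k-law : ∀ a b → k ⊙ a ⊙ b ≤ a
    s-law : ∀ a b c → s ⊙ a ⊙ b ⊙ c ≤ a ⊙ c ⊙ (b ⊙ c)

    adjunction : ∀ a b c → (a ≤ (b ⇒ c)) ⇔ (a ⊙ b ≤ c)

    Φ        : Pred Carrier ℓ
    Φ-resp-≈ : Φ Respects _≈_
    Φ-app    : ∀ {a b} → a ∈ Φ → b ∈ Φ → a ⊙ b ∈ Φ
    k∈Φ      : k ∈ Φ
    s∈Φ      : s ∈ Φ

-- Equality in A^I, hence in the functor laws, is the _≈_ of
-- the fibre; equality of functions between index sets is _≗_.

record IndexedPreorder (ι c ℓ₁ ℓ₂ : Level) : Set (suc (ι ⊔ c ⊔ ℓ₁ ⊔ ℓ₂)) where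
  field
    fibre   : Set ι → Preorder c ℓ₁ ℓ₂
    reindex : ∀ {I J} → (J → I) → PreorderHomomorphism (fibre I) (fibre J)

  module Fibre (I : Set ι) = Preorder (fibre I)

  infixr 9 _*_
  _*_ : ∀ {I J} → (J → I) → Fibre.Carrier I → Fibre.Carrier J
  f * φ = PreorderHomomorphism.⟦_⟧ (reindex f) φ

  field
    *-cong : ∀ {I J} {f g : J → I} → f ≗ g → ∀ φ → Fibre._≈_ J (f * φ) (g * φ)
    *-id   : ∀ {I} φ → Fibre._≈_ I (id * φ) φ
    *-∘    : ∀ {I J K} (f : J → I) (g : K → J) φ →
             Fibre._≈_ K ((f ∘ g) * φ) (g * f * φ)

  Iso : ∀ I → Rel (Fibre.Carrier I) ℓ₂
  Iso I φ ψ = Fibre._≲_ I φ ψ × Fibre._≲_ I ψ φ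

record IndexedMonotoneMap {ι c ℓ₁ ℓ₂ c′ ℓ₁′ ℓ₂′ : Level}
                          (C : IndexedPreorder ι c ℓ₁ ℓ₂)
                          (D : IndexedPreorder ι c′ ℓ₁′ ℓ₂′)
                          : Set (suc ι ⊔ c ⊔ ℓ₁ ⊔ ℓ₂ ⊔ c′ ⊔ ℓ₁′ ⊔ ℓ₂′) where
  private
    module C = IndexedPreorder C
    module D = IndexedPreorder D

  field
    component : ∀ I → PreorderHomomorphism (C.fibre I) (D.fibre I)

  at : ∀ I → C.Fibre.Carrier I → D.Fibre.Carrier I
  at I = PreorderHomomorphism.⟦_⟧ (component I)

  field
    natural : ∀ {I J} (f : J → I) φ → D.Iso J (at J (f C.* φ)) (f D.* at I φ)

record IndexedEquivalence {ι c ℓ₁ ℓ₂ c′ ℓ₁′ ℓ₂′ : Level}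
                          (C : IndexedPreorder ι c ℓ₁ ℓ₂)
                          (D : IndexedPreorder ι c′ ℓ₁′ ℓ₂′)
                          : Set (suc ι ⊔ c ⊔ ℓ₁ ⊔ ℓ₂ ⊔ c′ ⊔ ℓ₁′ ⊔ ℓ₂′) where
  private
    module C = IndexedPreorder C
    module D = IndexedPreorder D

  field
    σ : IndexedMonotoneMap C D
    τ : IndexedMonotoneMap D C

  private
    module σ = IndexedMonotoneMap σ
    module τ = IndexedMonotoneMap τ

  field
    τσ≅id : ∀ I φ → C.Iso I (τ.at I (σ.at I φ)) φ
    στ≅id : ∀ I ψ → D.Iso I (σ.at I (τ.at I ψ)) ψ

module _ {c ℓ : Level} (𝒜 : FullAdjunctionIOCA c ℓ) where
  open FullAdjunctionIOCA 𝒜 renaming (refl to ≤-refl)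

  Entails : ∀ {ι} {I : Set ι} → Rel (I → Carrier) (ι ⊔ c ⊔ ℓ)
  Entails φ ψ = ∃ λ r → r ∈ Φ × (∀ i → r ⊙ φ i ≤ ψ i)

  private
    ≈⇒⊢ : ∀ {ι} {I : Set ι} {φ ψ : I → Carrier} →
          (∀ i → φ i ≈ ψ i) → Entails φ ψ
    ≈⇒⊢ φ≈ψ =
      s ⊙ k ⊙ k , Φ-app (Φ-app s∈Φ k∈Φ) k∈Φ ,
      λ i → trans (s-law k k _) (trans (k-law _ _) (reflexive (φ≈ψ i)))

    ⊢-trans : ∀ {ι} {I : Set ι} {φ ψ θ : I → Carrier} →
              Entails φ ψ → Entails ψ θ → Entails φ θ
    ⊢-trans (r , r∈Φ , rφ≤ψ) (q , q∈Φ , qψ≤θ) =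
      s ⊙ (k ⊙ q) ⊙ r , Φ-app (Φ-app s∈Φ (Φ-app k∈Φ q∈Φ)) r∈Φ ,
      λ i → trans (s-law _ _ _)
              (trans (⊙-mono (k-law q _) (rφ≤ψ i)) (qψ≤θ i))

  -- The sets I range over an arbitrary universe Set ι: it may be large enough
  -- to contain the carriers.
  𝐏 : (ι : Level) → IndexedPreorder ι (ι ⊔ c) (ι ⊔ ℓ) (ι ⊔ c ⊔ ℓ)
  𝐏 ι = record
    { fibre = λ I → record
      { Carrier    = I → Carrier
      ; _≈_        = λ φ ψ → ∀ i → φ i ≈ ψ i
      ; _≲_        = Entails
      ; isPreorder = record
        { isEquivalence = record
          { refl  = λ _ → Eq.refl
          ; sym   = λ φ≈ψ i → Eq.sym (φ≈ψ i)
          ; trans = λ φ≈ψ ψ≈θ i → Eq.trans (φ≈ψ i) (ψ≈θ i)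
          }
        ; reflexive = ≈⇒⊢
        ; trans     = ⊢-trans
        }
      }
    ; reindex = λ f → record
      { ⟦_⟧ = λ φ → φ ∘ f
      ; isOrderHomomorphism = record
        { cong = λ φ≈ψ j → φ≈ψ (f j)
        ; mono = λ (r , r∈Φ , rφ≤ψ) → r , r∈Φ , λ j → rφ≤ψ (f j)
        }
      }
    ; *-cong = λ f≗g φ j → Eq.reflexive (cong φ (f≗g j))
    ; *-id   = λ _ _ → Eq.refl
    ; *-∘    = λ _ _ _ _ → Eq.refl
    }

-- The three ⊥-axioms are those of abstract Krivine structures; no closure under
-- control operators is assumed.
record AbstractKrivineStructure (ℓ : Level) : Set (suc ℓ) where
  infixl 9 _∙_
  infixr 8 _·_
  infix  4 _⊥_

  field
    Λ Π : Set ℓ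
    _⊥_ : REL Λ Π ℓ
    _·_ : Λ → Π → Π
    _∙_ : Λ → Λ → Λ
    QP  : Pred Λ ℓ
    K S : Λ

    app-⊥ : ∀ {t s π} → t ⊥ s · π → t ∙ s ⊥ π
    K-⊥   : ∀ {t s π} → t ⊥ π → K ⊥ t · s · π
    S-⊥   : ∀ {t s u π} → t ∙ u ∙ (s ∙ u) ⊥ π → S ⊥ t · s · u · π

    QP-app : ∀ {t s} → t ∈ QP → s ∈ QP → t ∙ s ∈ QP
    K∈QP   : K ∈ QP
    S∈QP   : S ∈ QP

module FromAKS {ℓ : Level} (𝒦 : AbstractKrivineStructure ℓ) where
  open AbstractKrivineStructure 𝒦

  infix 10 ⊥^_ _^⊥

  ⊥^_ : Pred Π ℓ → Pred Λ ℓ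
  (⊥^ P) t = ∀ π → π ∈ P → t ⊥ π

  _^⊥ : Pred Λ ℓ → Pred Π ℓ
  (L ^⊥) π = ∀ t → t ∈ L → t ⊥ π

  bar : Pred Π ℓ → Pred Π ℓ
  bar P = (⊥^ P) ^⊥

  hat : Pred Π ℓ → Pred Π ℓ
  hat P = ⋃ (∃ P) λ (π , _) → bar ｛ π ｝

  record 𝒫• : Set (suc ℓ) where
    constructor mk𝒫•
    field
      stacks : Pred Π ℓ
      hat≐   : hat stacks ≐ stacks

  open 𝒫• public

  E B : Λ
  E = S ∙ (K ∙ (S ∙ K ∙ K))
  B = S ∙ (K ∙ S) ∙ K

  private
    bar-refl : ∀ π → π ∈ bar ｛ π ｝
    bar-refl π t h = h π refl

    bar⇒ : ∀ {π π′ t} → π′ ∈ bar ｛ π ｝ → t ⊥ π → t ⊥ π′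
    bar⇒ h t⊥π = h _ λ { _ refl → t⊥π }

    bar-trans : ∀ {π π′ π″} → π′ ∈ bar ｛ π ｝ → π″ ∈ bar ｛ π′ ｝ → π″ ∈ bar ｛ π ｝
    bar-trans h h′ t t⊥ = bar⇒ h′ (h t t⊥)

    up : (P : 𝒫•) → ∀ {π π′} → π ∈ stacks P → π′ ∈ bar ｛ π ｝ → π′ ∈ stacks P
    up P π∈P h = proj₁ (hat≐ P) ((_ , π∈P) , h)

    mk : (P : Pred Π ℓ) → (∀ {π π′} → π ∈ P → π′ ∈ bar ｛ π ｝ → π′ ∈ P) → 𝒫•
    mk P c = mk𝒫• P ((λ ((_ , π∈P) , h) → c π∈P h) , λ π∈P → (_ , π∈P) , bar-refl _)

  -- hat P and L ^⊥ as elements of 𝒫•, for arbitrary P and L.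
  hat• : Pred Π ℓ → 𝒫•
  hat• P = mk (hat P) λ (p , h) h′ → p , bar-trans h h′

  _^⊥• : Pred Λ ℓ → 𝒫•
  L ^⊥• = mk (L ^⊥) λ π∈ h t t∈L → bar⇒ h (π∈ t t∈L)

  -- Infima for ⊇ are unions.
  ⋃• : {I : Set ℓ} → (I → 𝒫•) → 𝒫•
  ⋃• {I} P = mk (⋃ I λ i → stacks (P i)) λ (i , π∈) h → i , up (P i) π∈ h

  _∘•_ : 𝒫• → 𝒫• → 𝒫•
  P ∘• Q = mk
    (λ π → ∀ t π′ → t ∈ ⊥^ stacks Q → π′ ∈ bar ｛ π ｝ → t · π′ ∈ stacks P)
    λ π∈ h t π′ t∈ h′ → π∈ t π′ t∈ (bar-trans h h′)

  _→•_ : 𝒫• → 𝒫• → 𝒫•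
  P →• Q = hat• λ ρ →
    ∃ λ t → ∃ λ π → t ∈ ⊥^ stacks P × π ∈ stacks Q × ρ ≡ t · π

  k• s• : 𝒫•
  k• = ｛ E ∙ K ｝ ^⊥•
  s• = ｛ E ∙ (B ∙ E ∙ S) ｝ ^⊥•

  Φ• : Pred 𝒫• ℓ
  Φ• P = ∃ λ t → t ∈ QP × t ∈ ⊥^ stacks P

  private
    I-⊥ : ∀ {t π} → t ⊥ π → S ∙ K ∙ K ⊥ t · π
    I-⊥ h = app-⊥ (app-⊥ (S-⊥ (app-⊥ (app-⊥ (K-⊥ h)))))

    E-⊥ : ∀ {t u π} → t ∙ u ⊥ π → E ⊥ t · u · π
    E-⊥ h = app-⊥ (S-⊥ (app-⊥ (app-⊥ (app-⊥ (K-⊥ (I-⊥ h))))))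

    E∙-⊥ : ∀ {t u π} → t ∙ u ⊥ π → E ∙ t ⊥ u · π
    E∙-⊥ h = app-⊥ (E-⊥ h)

    B-⊥ : ∀ {t u v π} → t ⊥ u ∙ v · π → B ⊥ t · u · v · π
    B-⊥ h = app-⊥ (app-⊥ (S-⊥ (app-⊥ (app-⊥ (app-⊥ (K-⊥
              (S-⊥ (app-⊥ (app-⊥ (app-⊥ (K-⊥ h)))))))))))

    S∙∙-⊥ : ∀ {t u v π} → t ∙ v ∙ (u ∙ v) ⊥ π → S ∙ t ∙ u ⊥ v · π
    S∙∙-⊥ h = app-⊥ (app-⊥ (S-⊥ h))

    E∈QP : E ∈ QP
    E∈QP = QP-app S∈QP (QP-app K∈QP (QP-app (QP-app S∈QP K∈QP) K∈QP))

    B∈QP : B ∈ QP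
    B∈QP = QP-app (QP-app S∈QP (QP-app K∈QP S∈QP)) K∈QP

    app-∘• : ∀ {P Q t u} → t ∈ ⊥^ stacks P → u ∈ ⊥^ stacks Q →
             t ∙ u ∈ ⊥^ stacks (P ∘• Q)
    app-∘• t∈ u∈ π π∈ = app-⊥ (t∈ _ (π∈ _ π u∈ (bar-refl π)))

    k•-law : ∀ P Q → stacks P ⊆ stacks ((k• ∘• P) ∘• Q)
    k•-law P Q π∈P u π′ u∈ h t ρ t∈ h′ _ refl =
      E∙-⊥ (bar⇒ h′ (app-⊥ (K-⊥ (bar⇒ h (t∈ _ π∈P)))))

    s•-law : ∀ P Q R →
             stacks ((P ∘• R) ∘• (Q ∘• R)) ⊆ stacks (((s• ∘• P) ∘• Q) ∘• R)
    s•-law P Q R π∈ v π′ v∈ h u ρ′ u∈ h′ t ρ t∈ h″ _ refl =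
      E∙-⊥ (bar⇒ h″ (app-⊥ (app-⊥ (app-⊥ (B-⊥ (E-⊥ (bar⇒ h′ (S∙∙-⊥
        (app-⊥ (app-∘• {P} {R} t∈ v∈ _
          (π∈ _ π′ (app-∘• {Q} {R} u∈ v∈) h)))))))))))

    adjunction• : ∀ P Q R → (stacks P ⊇ stacks (Q →• R)) ⇔ (stacks (P ∘• Q) ⊇ stacks R)
    adjunction• P Q R = mk⇔
      (λ h {_} π∈ t π′ t∈ π′∈ →
        h ((_ , t , π′ , t∈ , up R π∈ π′∈ , refl) , bar-refl _))
      (λ { h {_} ((_ , t , π , t∈ , π∈ , refl) , ρ∈) →
        up P (h π∈ t π t∈ (bar-refl π)) ρ∈ })

  𝒜• : FullAdjunctionIOCA (suc ℓ) ℓ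
  𝒜• = record
    { poset = record
      { Carrier        = 𝒫•
      ; _≈_            = λ P Q → stacks P ≐ stacks Q
      ; _≤_            = λ P Q → stacks P ⊇ stacks Q
      ; isPartialOrder = record
        { isPreorder = record
          { isEquivalence = record
            { refl  = id , id
            ; sym   = swap
            ; trans = λ (f , g) (f′ , g′) → (λ x → f′ (f x)) , (λ x → g (g′ x))
            }
          ; reflexive = proj₂
          ; trans     = λ f g x → f (g x)
          }
        ; antisym = λ f g → g , f
        }
      }
    ; ⋀          = ⋃•
    ; ⋀-lower    = λ _ i π∈ → i , π∈
    ; ⋀-greatest = λ _ h (i , π∈) → h i π∈
    ; _⊙_        = _∘•_
    ; _⇒_        = _→•_
    ; ⊙-mono     = λ P⊇P′ Q⊇Q′ π∈ t π′ t∈ h →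
                     P⊇P′ (π∈ t π′ (λ ρ ρ∈ → t∈ ρ (Q⊇Q′ ρ∈)) h)
    ; ⇒-mono     = λ P⊆P′ Q⊇Q′ ((ρ , t , π , t∈ , π∈ , eq) , h) →
                     (ρ , t , π , (λ ρ ρ∈ → t∈ ρ (P⊆P′ ρ∈)) , Q⊇Q′ π∈ , eq) , h
    ; k          = k•
    ; s          = s•
    ; k-law      = λ P Q → k•-law P Q
    ; s-law      = λ P Q R → s•-law P Q R
    ; adjunction = adjunction•
    ; Φ          = Φ•
    ; Φ-resp-≈   = λ (_ , Q⊆P) (t , t∈QP , t∈) → t , t∈QP , λ π π∈ → t∈ π (Q⊆P π∈)
    ; Φ-app      = λ {P} {Q} (t , t∈QP , t∈) (u , u∈QP , u∈) →
                     t ∙ u , QP-app t∈QP u∈QP , app-∘• {P} {Q} t∈ u∈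
    ; k∈Φ        = E ∙ K , QP-app E∈QP K∈QP , λ π π∈ → π∈ _ refl
    ; s∈Φ        = E ∙ (B ∙ E ∙ S) , QP-app E∈QP (QP-app (QP-app B∈QP E∈QP) S∈QP) ,
                   λ π π∈ → π∈ _ refl
    }

𝒦• : ∀ {ℓ} → FullAdjunctionIOCA ℓ ℓ → AbstractKrivineStructure ℓ
𝒦• 𝒜 = record
  { Λ      = Carrier
  ; Π      = Carrier
  ; _⊥_    = _≤_
  ; _·_    = _⇒_
  ; _∙_    = _⊙_
  ; QP     = Φ
  ; K      = k
  ; S      = s
  ; app-⊥  = Equivalence.to (adjunction _ _ _)
  ; K-⊥    = λ t≤π → curry (curry (trans (k-law _ _) t≤π))
  ; S-⊥    = λ h → curry (curry (curry (trans (s-law _ _ _) h)))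
  ; QP-app = Φ-app
  ; K∈QP   = k∈Φ
  ; S∈QP   = s∈Φ
  }
  where
  open FullAdjunctionIOCA 𝒜

  curry : ∀ {a b c} → a ⊙ b ≤ c → a ≤ b ⇒ c
  curry = Equivalence.from (adjunction _ _ _)

{-# OPTIONS --safe #-}

-- For the structure 𝒦• 𝒜 the closure of {π} is the up-set of π, so the elements
-- of 𝒜• are the up-sets of 𝒜 ordered by ⊇.  The equivalence sends a to its
-- principal up-set and an up-set P to its infimum.  Because ⊥^ P consists of the
-- lower bounds of P, application in 𝒜• sees its argument P only through inf P;
-- hence P is isomorphic to the principal up-set of inf P, by the identity
-- combinator.

module Submission where

open import Defs
open import Level using (Level)
open import Data.Product using (∃; _,_; proj₁)
open import Function using (Equivalence)
open import Relation.Binary.PropositionalEquality using (refl)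
open import Relation.Unary using (Pred; _∈_; _⊇_; _≐_; ｛_｝)

module _ {c ℓ ι : Level} (𝒜 : FullAdjunctionIOCA c ℓ) {I : Set ι} where
  open FullAdjunctionIOCA 𝒜 using (Carrier; _≈_; module Eq)
  open IndexedPreorder.Fibre (𝐏 𝒜 ι) I using (reflexive)

  ≈⇒Iso : ∀ {φ ψ : I → Carrier} → (∀ i → φ i ≈ ψ i) → IndexedPreorder.Iso (𝐏 𝒜 ι) I φ ψ
  ≈⇒Iso {φ} {ψ} φ≈ψ =
    reflexive {φ} {ψ} φ≈ψ , reflexive {ψ} {φ} λ i → Eq.sym (φ≈ψ i)

module UpSets {ℓ : Level} (𝒜 : FullAdjunctionIOCA ℓ ℓ) where
  open FullAdjunctionIOCA 𝒜 renaming (refl to ≤-refl)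
  open FromAKS (𝒦• 𝒜)

  ↑ : Carrier → 𝒫•
  ↑ a = ｛ a ｝ ^⊥•

  ≤⇒∈↑ : ∀ {a π} → a ≤ π → π ∈ stacks (↑ a)
  ≤⇒∈↑ a≤π _ refl = a≤π

  ∈↑⇒≤ : ∀ {a π} → π ∈ stacks (↑ a) → a ≤ π
  ∈↑⇒≤ π∈ = π∈ _ refl

  ↑-anti : ∀ {a b} → a ≤ b → stacks (↑ a) ⊇ stacks (↑ b)
  ↑-anti a≤b π∈ = ≤⇒∈↑ (trans a≤b (∈↑⇒≤ π∈))

  ↑-cong : ∀ {a b} → a ≈ b → stacks (↑ a) ≐ stacks (↑ b)
  ↑-cong a≈b = ↑-anti (reflexive (Eq.sym a≈b)) , ↑-anti (reflexive a≈b)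

  ∈bar⇒≤ : ∀ {π π′} → π′ ∈ bar ｛ π ｝ → π ≤ π′
  -- Terms and stacks coincide, so `π` itself serves as a term orthogonal to `π`.
  ∈bar⇒≤ π′∈ = π′∈ _ λ { _ refl → ≤-refl }

  -- `∃ P` has level `ℓ` because carrier and truth values share it, so `⋀` applies.
  inf : Pred Carrier ℓ → Carrier
  inf P = ⋀ {∃ P} proj₁

  inf-lower : ∀ P → inf P ∈ ⊥^ P
  inf-lower P π π∈ = ⋀-lower proj₁ (π , π∈)

  inf-greatest : ∀ P {a} → a ∈ ⊥^ P → a ≤ inf P
  inf-greatest P a∈ = ⋀-greatest proj₁ λ (π , π∈) → a∈ π π∈

  inf-anti : ∀ P Q → P ⊇ Q → inf P ≤ inf Q
  inf-anti P Q P⊇Q = inf-greatest Q λ π π∈ → inf-lower P π (P⊇Q π∈)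

  inf-cong : ∀ P Q → P ≐ Q → inf P ≈ inf Q
  inf-cong P Q (P⊆Q , Q⊆P) = antisym (inf-anti P Q Q⊆P) (inf-anti Q P P⊆Q)

  inf-↑ : ∀ a → inf (stacks (↑ a)) ≈ a
  inf-↑ a = antisym (inf-lower (stacks (↑ a)) a (≤⇒∈↑ ≤-refl))
                    (inf-greatest (stacks (↑ a)) λ _ → ∈↑⇒≤)

  -- Every `t` in `⊥^ stacks P` is below the infimum, so `r ⊙ t ≤ π ≤ π′`; adjunction turns this
  -- into `r ≤ t ⇒ π′`.
  ↑-∘• : ∀ {r} P {π} → r ⊙ inf (stacks P) ≤ π → π ∈ stacks (↑ r ∘• P)
  ↑-∘• P r⊙P≤π t π′ t∈ π′∈ = ≤⇒∈↑ (Equivalence.from (adjunction _ _ _)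
    (trans (⊙-mono ≤-refl (inf-greatest (stacks P) t∈)) (trans r⊙P≤π (∈bar⇒≤ π′∈))))

  -- The infimum is itself a term orthogonal to `P`, so membership in `R ∘• P` can be tested at it,
  -- with `π′` taken to be `π`.
  ∘•-lower : ∀ {t} R P → t ∈ ⊥^ stacks R →
             t ⊙ inf (stacks P) ∈ ⊥^ stacks (R ∘• P)
  ∘•-lower R P t∈ π π∈ = Equivalence.to (adjunction _ _ _)
    (t∈ _ (π∈ _ π (inf-lower (stacks P)) λ _ u∈ → u∈ π refl))

  ↑-Φ : ∀ {r} → r ∈ Φ → ↑ r ∈ Φ•
  ↑-Φ {r} r∈Φ = r , r∈Φ , λ _ → ∈↑⇒≤

  module _ {ι : Level} {I : Set ι} where

    ↑-⊢ : ∀ (φ ψ : I → Carrier) →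
          Entails 𝒜 φ ψ → Entails 𝒜• (λ i → ↑ (φ i)) (λ i → ↑ (ψ i))
    ↑-⊢ φ ψ (r , r∈Φ , rφ≤ψ) = ↑ r , ↑-Φ r∈Φ , λ i π∈ →
      ↑-∘• (↑ (φ i)) (trans (⊙-mono ≤-refl (reflexive (inf-↑ (φ i))))
                       (trans (rφ≤ψ i) (∈↑⇒≤ π∈)))

    inf-⊢ : ∀ (φ ψ : I → 𝒫•) → Entails 𝒜• φ ψ →
            Entails 𝒜 (λ i → inf (stacks (φ i))) (λ i → inf (stacks (ψ i)))
    -- The realizer is the witness `t` below `R`, not `inf (stacks R)`: `Φ` is not assumed upward
    -- closed.
    inf-⊢ φ ψ (R , (t , t∈Φ , t∈) , Rφ⊇ψ) = t , t∈Φ , λ i →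
      inf-greatest (stacks (ψ i)) λ π π∈ → ∘•-lower R (φ i) t∈ π (Rφ⊇ψ i π∈)

    -- Comparing infima suffices even where the up-sets are not nested, since `↑-∘•` involves only
    -- the infimum of the argument.
    inf≤⇒⊢ : ∀ (φ ψ : I → 𝒫•) →
             (∀ i → inf (stacks (φ i)) ≤ inf (stacks (ψ i))) → Entails 𝒜• φ ψ
    inf≤⇒⊢ φ ψ φ≤ψ = ↑ (s ⊙ k ⊙ k) , ↑-Φ (Φ-app (Φ-app s∈Φ k∈Φ) k∈Φ) ,
      λ i {π} π∈ → ↑-∘• (φ i) (trans (s-law _ _ _) (trans (k-law _ _)
        (trans (φ≤ψ i) (inf-lower (stacks (ψ i)) π π∈))))

mainTheorem17 : ∀ {ℓ : Level} (ι : Level) (𝒜 : FullAdjunctionIOCA ℓ ℓ) →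
    IndexedEquivalence (𝐏 𝒜 ι) (𝐏 (FromAKS.𝒜• (𝒦• 𝒜)) ι)
mainTheorem17 ι 𝒜 = record
  { σ = record
    { component = λ _ → record
      { ⟦_⟧ = λ φ i → ↑ (φ i)
      ; isOrderHomomorphism = record
        { cong = λ φ≈ψ i → ↑-cong (φ≈ψ i)
        ; mono = λ {φ} {ψ} → ↑-⊢ φ ψ
        }
      }
    -- `σ` acts pointwise, so it commutes with reindexing definitionally.
    ; natural = λ f φ → ≈⇒Iso 𝒜• {φ = λ j → ↑ (φ (f j))} {λ j → ↑ (φ (f j))}
                          λ j → 𝒜•.Eq.refl {↑ (φ (f j))}
    }
  ; τ = record
    { component = λ _ → record
      { ⟦_⟧ = λ ψ i → inf (stacks (ψ i))
      ; isOrderHomomorphism = record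
        { cong = λ {φ} {ψ} φ≈ψ i → inf-cong (stacks (φ i)) (stacks (ψ i)) (φ≈ψ i)
        ; mono = λ {φ} {ψ} → inf-⊢ φ ψ
        }
      }
    ; natural = λ _ _ → ≈⇒Iso 𝒜 λ _ → Eq.refl
    }
  ; τσ≅id = λ _ φ → ≈⇒Iso 𝒜 λ i → inf-↑ (φ i)
  -- Both sides have the same infimum, by `inf-↑`.
  ; στ≅id = λ _ ψ →
      inf≤⇒⊢ (λ i → ↑ (inf (stacks (ψ i)))) ψ
        (λ i → reflexive (inf-↑ (inf (stacks (ψ i))))) ,
      inf≤⇒⊢ ψ (λ i → ↑ (inf (stacks (ψ i))))
        (λ i → reflexive (Eq.sym (inf-↑ (inf (stacks (ψ i))))))
  }
  where
  open UpSets 𝒜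
  open FullAdjunctionIOCA 𝒜 using (reflexive; module Eq)
  open FromAKS (𝒦• 𝒜) using (𝒜•; stacks)
  module 𝒜• = FullAdjunctionIOCA 𝒜•
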